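{- Let $p\ge 1$ be an integer. The map $\Phi_p$ is defined at every $p$-Łukasiewicz walk and restricts to a bijection $\mathcal L_p\to\mathcal T_p$ from $p$-Łukasiewicz walks to $p$-tandem walks. It preserves the total number of steps, maps $k$ to $\bar k$ (that is, $\bar k(\Phi_p(w))=k(w)$ for all $w\in\mathcal L_p$), and maps the number of $-1$ steps to the number of $(1,-1)$ steps (that is, for all $w\in\mathcal L_p$, the number of letters of $\Phi_p(w)$ equal to $(1,-1)$ equals the number of letters of $w$ equal to $-1$). The map $\Psi_p$ restricted to $\mathcal T_p$ is the inverse bijection $\mathcal T_p\to\mathcal L_p$.
   Context: Fix an integer $p\ge1$; $\mathbb N$ contains $0$; $A^*$ is the set of finite words on $A$, with empty word $\epsilon$. Alphabets: $\Sigma_p=\{ -1,0,1,\dots,p\}$; $S_p=\{(-j,p-j):0\le j\le p\}\cup\{(1,-1)\}\subset\mathbb Z^2$; $A_p=\{a_{\ell,m}:\ell,m\in\mathbb N,\ 0\le\ell+m\le p-1\}$ (formal letters). $p$-Łukasiewicz walks: $\mathcal L_p$ is the set of words $w\in\Sigma_p^*$ such that the sum of the letters of $w$ is $0$ and the sum of the letters of every prefix of $w$ is $\ge0$. $p$-tandem walks: $\mathcal T_p$ is the set of words $\bar w\in S_p^*$ such that for every prefix the sum of its letters (in $\mathbb Z^2$) lies in $\mathbb N^2$ (a walk from the origin in the quarter plane). Transitions. A transition relates an input letter $\mu\in\Sigma_p$ and a left counter $(H_L,v_L)\in A_p^*\times\mathbb N$ to a right counter $(H_R,v_R)\in A_p^*\times\mathbb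 N$ and an output letter $\bar a\in S_p$. Written as $\mu;\ (H_L,v_L)\to(H_R,v_R);\ \bar a$, with arbitrary $\Lambda\in A_p^*$, $\beta\in\mathbb N$, $a_{\ell,m}\in A_p$, they are: (T1) $p;\ (\Lambda,\beta)\to(\Lambda,\beta+p);\ (0,p)$. (T2) $q;\ (\Lambda,0)\to(\Lambda,q);\ (0,p)$, for $0\le q\le p-1$. (T3) $-1;\ (\Lambda a_{\ell,m},0)\to(\Lambda,\ell);\ (-m-1,p-m-1)$, for $\ell+m\le p-1$. (T4) $-1;\ (\Lambda a_{\ell,m},\beta+1)\to(\Lambda,\beta+\ell+1);\ (-m-1,p-m-1)$, for $\ell+m=p-1$. (T5) $q;\ (\Lambda,\beta+1)\to(\Lambda a_{q,0},\beta);\ (1,-1)$, for $0\le q\le p-1$. (T6) $-1;\ (\Lambda a_{\ell,m},\beta+1)\to(\Lambda a_{\ell,m+1},\beta);\ (1,-1)$, for $\ell+m\le p-2$. (T7) $-1;\ (\epsilon,\beta+1)\to(\epsilon,\beta);\ (1,-1)$. (T8) $-1;\ (\epsilon,0)\to$ error. Each triple $(\mu,H_L,v_L)\in\Sigma_p\times A_p^*\times\mathbb N$ matches the left side of exactly one of (T1)–(T8), and each triple $(H_R,v_R,\bar a)\in A_p^*\times\mathbb N\times S_p$ matches the right side of exactly one of (T1)–(T7) and determines $(\mu,H_L,v_L)$. Forward (LR) process and $\Phi_p$: given $w=w_1\cdots w_n\in\Sigma_p^*$, start with $(H_0,v_0)=(\epsilon,0)$; for $i=1,\dots,n$ apply the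 unique transition matching $(w_i,H_{i-1},v_{i-1})$ to get $(H_i,v_i)$ and $\bar w_i$. If (T8) is ever used, $\Phi_p(w)$ is undefined; otherwise $\Phi_p(w)=\bar w_1\cdots\bar w_n\in S_p^*$. Backward (RL) process and $\Psi_p$: given $\bar w=\bar w_1\cdots\bar w_n\in S_p^*$, start with $(H_n,v_n)=(\epsilon,0)$; for $i=n,n-1,\dots,1$ apply in reverse the unique transition among (T1)–(T7) matching $(H_i,v_i,\bar w_i)$ to get $w_i$ and $(H_{i-1},v_{i-1})$. Then $\Psi_p(\bar w)=w_1\cdots w_n\in\Sigma_p^*$. Statistics: for $w\in\Sigma_p^*$, $k(w)$ is the sum over the letters $\mu$ of $w$ of the quantity equal to $p$ if $0\le\mu\le p$ and to $-2$ if $\mu=-1$. For $\bar w\in S_p^*$, $\bar k(\bar w)$ is the sum over the letters $(\bar a_1,\bar a_2)$ of $\bar w$ of $\bar a_2-\bar a_1$. -}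

module Defs where

open import Data.Empty using (⊥-elim-irr)
open import Data.Integer as ℤ using (ℤ; +_; 0ℤ; 1ℤ; -1ℤ)
open import Data.List using (List; []; _∷_; map; foldr; filter; length)
open import Data.List.Relation.Binary.Prefix.Heterogeneous using (Prefix)
open import Data.Maybe as Maybe using (Maybe; just; nothing)
open import Data.Nat using (ℕ; zero; suc; _+_; _∸_; _≤_; _<_; z≤n; s≤s; _≟_; _≤?_; _<?_)
open import Data.Nat.Properties
open import Data.Product using (∃₂; _×_; _,_; proj₁; proj₂; zip)
open import Data.Product.Properties using (≡-dec)
open import Data.Sum using (_⊎_; inj₁; inj₂)
open import Function using (_∘_)
open import Level using (0ℓ)
open import Relation.Binary.Bundles using (Setoid)
import Relation.Binary.Construct.On as On
open import Relation.Binary.PropositionalEquality using (_≡_; refl; sym; trans; cong; subst; setoid)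
open import Relation.Nullary using (¬_; yes; no; contradiction)
open import Relation.Nullary.Decidable using (recompute)
open import Relation.Unary using (Pred)

-- Bounds are irrelevant arguments, so letters are equal as
-- soon as their numerical data are.

-- Σ_p = {-1, 0, …, p}
data LStep (p : ℕ) : Set where
  down : LStep p
  up   : (q : ℕ) → .(q ≤ p) → LStep p

-- S_p = {(-j , p - j) : 0 ≤ j ≤ p} ∪ {(1 , -1)}
data TStep (p : ℕ) : Set where
  SE : TStep p
  NW : (j : ℕ) → .(j ≤ p) → TStep p

-- A_p; the condition ℓ + m ≤ p - 1 is written without truncated
-- subtraction.
data CounterLetter (p : ℕ) : Set where
  a : (ℓ m : ℕ) → .(ℓ + m < p) → CounterLetter p

valueL : ∀ {p} → LStep p → ℤ
valueL down     = -1ℤ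
valueL (up q _) = + q

valueT : ∀ {p} → TStep p → ℤ × ℤ
valueT     SE       = 1ℤ , -1ℤ
valueT {p} (NW j _) = ℤ.- (+ j) , + p ℤ.- + j

sumℤ : List ℤ → ℤ
sumℤ = foldr ℤ._+_ 0ℤ

sumℤ² : List (ℤ × ℤ) → ℤ × ℤ
sumℤ² = foldr (zip ℤ._+_ ℤ._+_) (0ℤ , 0ℤ)

Łukasiewicz : ∀ p → Pred (List (LStep p)) 0ℓ
Łukasiewicz p w =
    sumℤ (map valueL w) ≡ 0ℤ
  × (∀ u → Prefix _≡_ u w → 0ℤ ℤ.≤ sumℤ (map valueL u))

Tandem : ∀ p → Pred (List (TStep p)) 0ℓ
Tandem p w̄ =
  ∀ ū → Prefix _≡_ ū w̄ → let (x , y) = sumℤ² (map valueT ū) in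
    0ℤ ℤ.≤ x × 0ℤ ℤ.≤ y

-- A subset as a setoid: elements are compared without regard to the
-- membership proofs.
subset : {A : Set} → Pred A 0ℓ → Setoid 0ℓ 0ℓ
subset {A} P = On.setoid (setoid A) (proj₁ {B = P})

-- Transitions act on the right end of a word over A_p, so such words are
-- stored with their rightmost letter at the head of the list, and Λ ▸ x
-- is the word Λ followed by the letter x.
infixl 5 _▸_
pattern ε       = []
pattern _▸_ Λ x = x ∷ Λ

Counter : ℕ → Set
Counter p = List (CounterLetter p) × ℕ

infix 3 _⨾_⟶_⨾_
data _⨾_⟶_⨾_ {p : ℕ} : LStep p → Counter p → Counter p → TStep p → Set where

  T1 : ∀ {Λ β} .{p≤p : p ≤ p} .{0≤p : 0 ≤ p} →
       up p p≤p ⨾ (Λ , β) ⟶ (Λ , β + p) ⨾ NW 0 0≤p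

  T2 : ∀ {Λ q} .{q≤p : q ≤ p} .{0≤p : 0 ≤ p} → .(q < p) →
       up q q≤p ⨾ (Λ , 0) ⟶ (Λ , q) ⨾ NW 0 0≤p

  T3 : ∀ {Λ ℓ m} .{h : ℓ + m < p} .{m<p : suc m ≤ p} →
       down ⨾ (Λ ▸ a ℓ m h , 0) ⟶ (Λ , ℓ) ⨾ NW (suc m) m<p

  -- ℓ + m = p - 1
  T4 : ∀ {Λ ℓ m β} .{h : ℓ + m < p} .{m<p : suc m ≤ p} → .(suc (ℓ + m) ≡ p) →
       down ⨾ (Λ ▸ a ℓ m h , suc β) ⟶ (Λ , suc (β + ℓ)) ⨾ NW (suc m) m<p

  T5 : ∀ {Λ q β} .{q≤p : q ≤ p} .{h : q + 0 < p} →
       up q q≤p ⨾ (Λ , suc β) ⟶ (Λ ▸ a q 0 h , β) ⨾ SE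

  -- ℓ + m ≤ p - 2 amounts to a_{ℓ,m+1} being a letter of A_p.
  T6 : ∀ {Λ ℓ m β} .{h : ℓ + m < p} .{h′ : ℓ + suc m < p} →
       down ⨾ (Λ ▸ a ℓ m h , suc β) ⟶ (Λ ▸ a ℓ (suc m) h′ , β) ⨾ SE

  T7 : ∀ {β} →
       down ⨾ (ε , suc β) ⟶ (ε , β) ⨾ SE

data _⨾_⟶error {p : ℕ} : LStep p → Counter p → Set where
  T8 : down ⨾ (ε , 0) ⟶error

-- The processes apply whatever forward and backward find; by
-- forward-unique, error-exclusive and backward-unique there is nothing
-- else to find.
forward : ∀ {p} (μ : LStep p) (c : Counter p) →
          (∃₂ λ c′ ā → μ ⨾ c ⟶ c′ ⨾ ā) ⊎ (μ ⨾ c ⟶error)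
forward {p} (up q q≤p) (Λ , v) with q ≟ p
forward {p} (up q q≤p) (Λ , v)     | yes refl = inj₁ ((Λ , v + p) , NW 0 z≤n , T1)
forward {p} (up q q≤p) (Λ , zero)  | no q≢p   =
  inj₁ ((Λ , q) , NW 0 z≤n , T2 (≤∧≢⇒< q≤p q≢p))
forward {p} (up q q≤p) (Λ , suc β) | no q≢p   =
  inj₁ ((Λ ▸ a q 0 (subst (_< p) (sym (+-identityʳ q)) (≤∧≢⇒< q≤p q≢p)) , β) , SE , T5)
forward down (ε , zero)  = inj₂ T8
forward down (ε , suc β) = inj₁ ((ε , β) , SE , T7)
forward down (Λ ▸ a ℓ m h , zero) =
  inj₁ ((Λ , ℓ) , NW (suc m) (≤-trans (s≤s (m≤n+m m ℓ)) h) , T3)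
forward {p} down (Λ ▸ a ℓ m h , suc β) with suc (ℓ + m) ≟ p
... | yes eq = inj₁ ((Λ , suc (β + ℓ)) , NW (suc m) (≤-trans (s≤s (m≤n+m m ℓ)) h) , T4 eq)
... | no neq =
  inj₁ ((Λ ▸ a ℓ (suc m) (subst (_< p) (sym (+-suc ℓ m)) (≤∧≢⇒< h neq)) , β) , SE , T6)

subst-v : ∀ {p} {μ : LStep p} {c Λ v v′ ā} → v ≡ v′ →
          μ ⨾ c ⟶ (Λ , v) ⨾ ā → μ ⨾ c ⟶ (Λ , v′) ⨾ ā
subst-v refl t = t

backward : ∀ {p} (c′ : Counter p) (ā : TStep p) →
           ∃₂ λ μ c → μ ⨾ c ⟶ c′ ⨾ ā
backward {p} (Λ , v) (NW zero _) with p ≤? v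
... | yes p≤v = up p ≤-refl , (Λ , v ∸ p) ,
                subst-v (m∸n+n≡m p≤v) T1
... | no  p≰v = up v (≰⇒≥ p≰v) , (Λ , 0) , T2 (≰⇒> p≰v)
backward {p} (Λ , v) (NW (suc m) m<p) with v + m <? p
... | yes h  = down , (Λ ▸ a v m h , 0) , T3
... | no  ¬h = down , (Λ ▸ a ℓ m (≤-reflexive eq) , suc (v ∸ suc ℓ)) ,
               subst-v v-eq (T4 eq)
  where
  ℓ : ℕ
  ℓ = p ∸ suc m
  eq : suc (ℓ + m) ≡ p
  eq = trans (sym (+-suc ℓ m)) (m∸n+n≡m (recompute (suc m ≤? p) m<p))
  ℓ<v : ℓ < v
  ℓ<v = +-cancelʳ-≤ m (suc ℓ) v (subst (_≤ v + m) (sym eq) (≮⇒≥ ¬h))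
  v-eq : suc ((v ∸ suc ℓ) + ℓ) ≡ v
  v-eq = trans (sym (+-suc (v ∸ suc ℓ) ℓ)) (m∸n+n≡m ℓ<v)
backward (ε , v) SE = down , (ε , suc v) , T7
backward {p} (Λ ▸ a ℓ zero h , v) SE =
  up ℓ (<⇒≤ (subst (_< p) (+-identityʳ ℓ) h)) , (Λ , suc v) , T5
backward {p} (Λ ▸ a ℓ (suc m) h , v) SE =
  down , (Λ ▸ a ℓ m (<-trans (n<1+n _) (subst (_< p) (+-suc ℓ m) h)) , suc v) , T6

forward-unique : ∀ {p} {μ : LStep p} {c c₁ c₂ ā₁ ā₂} →
                 μ ⨾ c ⟶ c₁ ⨾ ā₁ → μ ⨾ c ⟶ c₂ ⨾ ā₂ → c₁ ≡ c₂ × ā₁ ≡ ā₂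
forward-unique T1       T1       = refl , refl
forward-unique T1       (T2 p<p) = ⊥-elim-irr (<-irrefl refl p<p)
forward-unique T1       (T5 {h = h}) = ⊥-elim-irr (m+n≮m _ 0 h)
forward-unique (T2 p<p) T1       = ⊥-elim-irr (<-irrefl refl p<p)
forward-unique (T2 _)   (T2 _)   = refl , refl
forward-unique T3       T3       = refl , refl
forward-unique (T4 _)   (T4 _)   = refl , refl
forward-unique (T4 {ℓ = ℓ} {m} eq) (T6 {h′ = h′}) =
  ⊥-elim-irr (<-irrefl (trans (+-suc ℓ m) eq) h′)
forward-unique (T5 {h = h}) T1   = ⊥-elim-irr (m+n≮m _ 0 h)
forward-unique T5       T5       = refl , refl
forward-unique (T6 {ℓ = ℓ} {m} {h′ = h′}) (T4 eq) =
  ⊥-elim-irr (<-irrefl (trans (+-suc ℓ m) eq) h′)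
forward-unique T6       T6       = refl , refl
forward-unique T7       T7       = refl , refl

error-exclusive : ∀ {p} {μ : LStep p} {c c′ ā} →
                  μ ⨾ c ⟶error → ¬ (μ ⨾ c ⟶ c′ ⨾ ā)
error-exclusive T8 ()

backward-unique : ∀ {p} {μ : LStep p} {c c′ ā} → μ ⨾ c ⟶ c′ ⨾ ā →
                  let (μ′ , c″ , _) = backward c′ ā in μ′ ≡ μ × c″ ≡ c
backward-unique {p} (T1 {β = β}) with p ≤? β + p
... | yes _     = refl , cong (_ ,_) (m+n∸n≡m β p)
... | no  p≰β+p = contradiction (m≤n+m p β) p≰β+p
backward-unique {p} (T2 {q = q} q<p) with p ≤? q
... | yes p≤q = ⊥-elim-irr (<⇒≱ q<p p≤q)
... | no  _   = refl , refl
backward-unique {p} (T3 {ℓ = ℓ} {m} {h}) with ℓ + m <? p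
... | yes _  = refl , refl
... | no  ¬h = ⊥-elim-irr (¬h h)
backward-unique {p} (T4 {ℓ = ℓ} {m} {β} eq) with suc (β + ℓ) + m <? p
... | yes h = ⊥-elim-irr (<⇒≱ h (≤-trans (≤-reflexive (sym eq)) (s≤s (+-monoˡ-≤ m (m≤n+m ℓ β)))))
... | no  _ = refl , lemma (p ∸ suc m) ℓ-eq
  where
  ℓ-eq : p ∸ suc m ≡ ℓ
  ℓ-eq = trans (cong (_∸ suc m) (sym (recompute (_ ≟ _) eq))) (m+n∸n≡m ℓ m)
  lemma : ∀ {Λ} ℓ′ .{h h′} → ℓ′ ≡ ℓ →
          _≡_ {A = Counter p} (Λ ▸ a ℓ′ m h′ , suc (β + ℓ ∸ ℓ′)) (Λ ▸ a ℓ m h , suc β)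
  lemma _ refl = cong (λ v → _ , suc v) (m+n∸n≡m β ℓ)
backward-unique T5 = refl , refl
backward-unique T6 = refl , refl
backward-unique T7 = refl , refl

LR : ∀ {p} → Counter p → List (LStep p) → Maybe (List (TStep p))
LR c []      = just []
LR c (μ ∷ w) with forward μ c
... | inj₁ (c′ , ā , _) = Maybe.map (ā ∷_) (LR c′ w)
... | inj₂ _            = nothing

Φ : ∀ p → List (LStep p) → Maybe (List (TStep p))
Φ p = LR (ε , 0)

-- The counter to the left of the given word, together with the word
-- produced.
RL : ∀ {p} → List (TStep p) → Counter p × List (LStep p)
RL []      = (ε , 0) , []
RL (ā ∷ w̄) =
  let (c′ , w)    = RL w̄
      (μ , c , _) = backward c′ ā
  in c , μ ∷ w

Ψ : ∀ p → List (TStep p) → List (LStep p)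
Ψ p = proj₂ ∘ RL

kLetter : ∀ {p} → LStep p → ℤ
kLetter     down     = ℤ.- (+ 2)
kLetter {p} (up _ _) = + p

k : ∀ {p} → List (LStep p) → ℤ
k = sumℤ ∘ map kLetter

k̄Letter : ∀ {p} → TStep p → ℤ
k̄Letter ā = let (a₁ , a₂) = valueT ā in a₂ ℤ.- a₁

k̄ : ∀ {p} → List (TStep p) → ℤ
k̄ = sumℤ ∘ map k̄Letter

#-1 : ∀ {p} → List (LStep p) → ℕ
#-1 = length ∘ filter (λ μ → valueL μ ℤ.≟ -1ℤ)

#SE : ∀ {p} → List (TStep p) → ℕ
#SE = length ∘ filter (λ ā → ≡-dec ℤ._≟_ ℤ._≟_ (valueT ā) (1ℤ , -1ℤ))

{-# OPTIONS --safe #-}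

-- Along every run of the transitions, three quantities are controlled.
-- The height v + Σ (ℓ + 1), summed over the letters a_{ℓ,m} of the stack,
-- follows the Łukasiewicz walk exactly; hence the error state is reached
-- exactly when that walk goes below 0, and a run from (ε , 0) ends in
-- (ε , 0) exactly when the walk ends at height 0.
-- The numbers Σ (m + 1) and v follow the two coordinates of the tandem
-- walk, except that when they are 0 they may grow by less than the
-- coordinate does.  So a run from (ε , 0) keeps both coordinates
-- nonnegative.  Conversely, in a run ending in (ε , 0), at the first time
-- that such a number vanishes the coordinate equals minus its initial
-- value; if the walk stays in the quarter plane, that value was 0.
module Submission where

open import Defs
open import Algebra.Properties.CommutativeSemigroup using (xy∙z≈xz∙y; x∙yz≈xz∙y)
open import Data.Empty using (⊥-elim)
open import Data.Integer as ℤ using (ℤ; +_; 0ℤ; 1ℤ)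
import Data.Integer.Properties as ℤ
open import Data.Integer.Tactic.RingSolver using (solve-∀)
open import Data.List using (List; []; _∷_; length; map)
open import Data.List.Relation.Binary.Prefix.Heterogeneous using (Prefix; []; _∷_)
open import Data.Maybe as Maybe using (just)
open import Data.Maybe.Properties using (just-injective)
open import Data.Nat using (ℕ; zero; suc; _+_; _≤_; _<_; _≥_; z≤n; _≟_; _<?_)
open import Data.Nat.ListAction using (sum)
open import Data.Nat.Properties
open import Data.Product using (Σ-syntax; ∃; ∃₂; _×_; _,_; proj₁; proj₂)
open import Data.Sum using (_⊎_; inj₁; inj₂)
open import Function using (_∘_)
open import Function.Bundles using (Inverse)
open import Relation.Binary.PropositionalEquality
  using (_≡_; refl; sym; trans; cong; cong₂; subst; module ≡-Reasoning)
open import Relation.Nullary.Decidable using (recompute)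

-- Runs of the transitions, read in either direction.

private
  variable
    p : ℕ
    c c′ c″ : Counter p
    w : List (LStep p)
    w̄ : List (TStep p)

-- A run favours neither direction: `LR` recovers it from the left and `RL` from the right. Both
-- maps are thus compared with one object instead of with each other.
data Run {p : ℕ} : Counter p → List (LStep p) → Counter p → List (TStep p) → Set where
  []  : Run c [] c []
  _∷_ : ∀ {μ ā} → μ ⨾ c ⟶ c′ ⨾ ā → Run c′ w c″ w̄ → Run c (μ ∷ w) c″ (ā ∷ w̄)

LR-run : Run c w c′ w̄ → LR c w ≡ just w̄
LR-run [] = refl
LR-run {c = c} {w = μ ∷ _} (t ∷ r) with forward μ c
... | inj₂ e = ⊥-elim (error-exclusive e t)
... | inj₁ (_ , _ , t′) with refl , refl ← forward-unique t′ t = cong (Maybe.map (_ ∷_)) (LR-run r)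

RL-run : Run c w (ε , 0) w̄ → RL w̄ ≡ (c , w)
RL-run [] = refl
RL-run {w̄ = ā ∷ w̄} (t ∷ r) rewrite RL-run r with refl , refl ← backward-unique t = refl

-- `backward` is total, so every word over `TStep` has such a run; only its left counter is unknown.
run-RL : (w̄ : List (TStep p)) → Run (proj₁ (RL w̄)) (proj₂ (RL w̄)) (ε , 0) w̄
run-RL []      = []
run-RL (ā ∷ w̄) = proj₂ (proj₂ (backward (proj₁ (RL w̄)) ā)) ∷ run-RL w̄

run-length : Run c w c′ w̄ → length w̄ ≡ length w
run-length []      = refl
run-length (_ ∷ r) = cong suc (run-length r)

run-prefixˡ : ∀ {u} → Prefix _≡_ u w → Run c w c′ w̄ → ∃₂ λ c″ ū → Run c u c″ ū
run-prefixˡ []         _       = _ , _ , []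
run-prefixˡ (refl ∷ π) (t ∷ r) = let _ , _ , r′ = run-prefixˡ π r in _ , _ , t ∷ r′

run-prefixʳ : ∀ {ū} → Prefix _≡_ ū w̄ → Run c w c′ w̄ → ∃₂ λ c″ u → Run c u c″ ū
run-prefixʳ []         _       = _ , _ , []
run-prefixʳ (refl ∷ π) (t ∷ r) = let _ , _ , r′ = run-prefixʳ π r in _ , _ , t ∷ r′

-- The height and the Łukasiewicz walk.

ℓ+1 m+1 : CounterLetter p → ℕ
ℓ+1 (a ℓ _ _) = suc ℓ
m+1 (a _ m _) = suc m

height width : Counter p → ℕ
height (Λ , v) = v + sum (map ℓ+1 Λ)
width  (Λ , _) = sum (map m+1 Λ)

height-step : ∀ {μ ā} → μ ⨾ c ⟶ c′ ⨾ ā → + height c′ ≡ + height c ℤ.+ valueL μ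
height-step {p} (T1 {β = β})       = cong +_ (xy∙z≈xz∙y +-commutativeSemigroup β p _)
height-step (T2 {q = q} _)         = cong +_ (+-comm q _)
height-step T3                     = refl
height-step (T4 {ℓ = ℓ} {β = β} _) =
  cong +_ (trans (cong suc (+-assoc β ℓ _)) (sym (+-suc β _)))
height-step (T5 {q = q} {β})       =
  cong +_ (trans (+-suc β _) (x∙yz≈xz∙y +-commutativeSemigroup (suc β) q _))
height-step T6 = refl
height-step T7 = refl

height-run : Run c w c′ w̄ → + height c′ ≡ + height c ℤ.+ sumℤ (map valueL w)
height-run {c = c} [] = sym (ℤ.+-identityʳ (+ height c))
height-run {c = c} {w = μ ∷ w} {c′ = c″} (_∷_ {c′ = c′} t r) = begin
  + height c″                                            ≡⟨ height-run r ⟩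
  + height c′ ℤ.+ sumℤ (map valueL w)                    ≡⟨ cong (ℤ._+ _) (height-step t) ⟩
  (+ height c ℤ.+ valueL μ) ℤ.+ sumℤ (map valueL w)      ≡⟨ ℤ.+-assoc (+ height c) (valueL μ) _ ⟩
  + height c ℤ.+ (valueL μ ℤ.+ sumℤ (map valueL w))      ∎
  where open ≡-Reasoning

-- Each stack letter contributes `suc ℓ`, hence at least 1, so height 0 leaves no room for letters.
height≡0⇒start : height c ≡ 0 → c ≡ (ε , 0)
height≡0⇒start {c = ε , _} eq = cong (ε ,_) (trans (sym (+-identityʳ _)) eq)
height≡0⇒start {c = Λ ▸ a _ _ _ , zero}  ()
height≡0⇒start {c = Λ ▸ a _ _ _ , suc _} ()

run-LR : ∀ (c : Counter p) w →
         (∀ u → Prefix _≡_ u w → 0ℤ ℤ.≤ + height c ℤ.+ sumℤ (map valueL u)) →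
         ∃₂ λ c′ w̄ → Run c w c′ w̄
run-LR c []      _ = _ , _ , []
run-LR c (μ ∷ w) nonneg with forward μ c
-- The error occurs only at `(ε , 0)`, of height 0, where the one-letter prefix `down` would reach
-- -1.
... | inj₂ T8 with () ← nonneg (down ∷ []) (refl ∷ [])
... | inj₁ (c′ , ā , t) =
  let _ , _ , r = run-LR c′ w λ u π → subst (0ℤ ℤ.≤_) (shift u) (nonneg (μ ∷ u) (refl ∷ π))
  in _ , _ , t ∷ r
  where
  shift : ∀ u → + height c ℤ.+ (valueL μ ℤ.+ sumℤ (map valueL u)) ≡
                + height c′ ℤ.+ sumℤ (map valueL u)
  shift u = trans (sym (ℤ.+-assoc (+ height c) (valueL μ) _)) (cong (ℤ._+ _) (sym (height-step t)))

-- Lossy tracking of a coordinate.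

-- The queue recursion: Z moves along with the walk whose steps are given
-- by f, except that at 0 part of an increment may be lost.
_Tracks_ : (Counter p → ℕ) → (TStep p → ℤ) → Set
Z Tracks f = ∀ {μ c c′ ā} → μ ⨾ c ⟶ c′ ⨾ ā →
             (+ Z c′ ≡ + Z c ℤ.+ f ā) ⊎ (Z c ≡ 0 × + Z c′ ℤ.≤ f ā)

module _ {Z : Counter p → ℕ} {f : TStep p → ℤ} (tracks : Z Tracks f) where

  tracks⇒≤ : Run c w c′ w̄ → + Z c′ ℤ.≤ + Z c ℤ.+ sumℤ (map f w̄)
  tracks⇒≤ {c = c} [] = ℤ.≤-reflexive (sym (ℤ.+-identityʳ (+ Z c)))
  tracks⇒≤ {c = c} {c′ = c″} {w̄ = ā ∷ w̄} (_∷_ {c′ = c′} t r) = begin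
    + Z c″                                     ≤⟨ tracks⇒≤ r ⟩
    + Z c′ ℤ.+ sumℤ (map f w̄)                  ≤⟨ ℤ.+-monoˡ-≤ _ (step (tracks t)) ⟩
    (+ Z c ℤ.+ f ā) ℤ.+ sumℤ (map f w̄)         ≡⟨ ℤ.+-assoc (+ Z c) (f ā) _ ⟩
    + Z c ℤ.+ (f ā ℤ.+ sumℤ (map f w̄))         ∎
    where
    open ℤ.≤-Reasoning
    step : (+ Z c′ ≡ + Z c ℤ.+ f ā) ⊎ (Z c ≡ 0 × + Z c′ ℤ.≤ f ā) → + Z c′ ℤ.≤ + Z c ℤ.+ f ā
    step (inj₁ eq)         = ℤ.≤-reflexive eq
    step (inj₂ (z≡0 , le)) rewrite z≡0 = ℤ.≤-trans le (ℤ.≤-reflexive (sym (ℤ.+-identityˡ (f ā))))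

  -- The prefix stops just before the first step classified as lossy: `Z` is 0 there and all earlier
  -- steps were exact. Without such a step, the whole word serves.
  tracks⇒hits-0 : Run c w c′ w̄ → Z c′ ≡ 0 →
                  ∃ λ ū → Prefix _≡_ ū w̄ × + Z c ℤ.+ sumℤ (map f ū) ≡ 0ℤ
  tracks⇒hits-0 [] z≡0 = [] , [] , trans (ℤ.+-identityʳ _) (cong +_ z≡0)
  tracks⇒hits-0 {c = c} {w̄ = ā ∷ _} (t ∷ r) z≡0 with tracks t
  ... | inj₂ (zc≡0 , _) = [] , [] , trans (ℤ.+-identityʳ _) (cong +_ zc≡0)
  ... | inj₁ eq =
    let ū , π , hit = tracks⇒hits-0 r z≡0
    in ā ∷ ū , refl ∷ π ,
       trans (sym (ℤ.+-assoc (+ Z c) (f ā) _)) (trans (cong (ℤ._+ _) (sym eq)) hit)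

  nonneg⇒starts-0 : Run c w c′ w̄ → Z c′ ≡ 0 →
                    (∀ ū → Prefix _≡_ ū w̄ → 0ℤ ℤ.≤ sumℤ (map f ū)) → Z c ≡ 0
  nonneg⇒starts-0 {c = c} r z≡0 nonneg =
    let ū , π , hit = tracks⇒hits-0 r z≡0
    in n≤0⇒n≡0 (ℤ.drop‿+≤+ (begin
         + Z c                          ≡⟨ ℤ.+-identityʳ (+ Z c) ⟨
         + Z c ℤ.+ 0ℤ                   ≤⟨ ℤ.+-monoʳ-≤ (+ Z c) (nonneg ū π) ⟩
         + Z c ℤ.+ sumℤ (map f ū)       ≡⟨ hit ⟩
         0ℤ                             ∎))
    where open ℤ.≤-Reasoning

[m+n]-m≡n : ∀ m n → + (m + n) ℤ.- + m ≡ + n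
[m+n]-m≡n m n = trans (cong (ℤ._- + m) (ℤ.pos-+ m n)) (lemma (+ m) (+ n))
  where
  lemma : ∀ i j → (i ℤ.+ j) ℤ.- i ≡ j
  lemma = solve-∀

-- Width and `v` against the two coordinates.

x̄ ȳ : TStep p → ℤ
x̄ = proj₁ ∘ valueT
ȳ = proj₂ ∘ valueT

-- Only `T7` is lossy: the abscissa grows by 1 while the stack stays empty.
width-tracks-x̄ : width {p} Tracks x̄
width-tracks-x̄ T1               = inj₁ (sym (ℤ.+-identityʳ _))
width-tracks-x̄ (T2 _)           = inj₁ (sym (ℤ.+-identityʳ _))
width-tracks-x̄ (T3 {m = m})     = inj₁ (sym ([m+n]-m≡n (suc m) _))
width-tracks-x̄ (T4 {m = m} _)   = inj₁ (sym ([m+n]-m≡n (suc m) _))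
width-tracks-x̄ (T5 {Λ})         = inj₁ (cong +_ (+-comm 1 (sum (map m+1 Λ))))
width-tracks-x̄ (T6 {Λ} {m = m}) = inj₁ (cong +_ (+-comm 1 (suc m + sum (map m+1 Λ))))
width-tracks-x̄ T7               = inj₂ (refl , ℤ.+≤+ z≤n)

-- Only `T2` and `T3` are lossy, both starting from `v = 0`: the new value is `q < p` in place of
-- `p`, or `ℓ ≤ p - m - 1` in place of `p - m - 1`. The side condition of `T4` makes that bound an
-- equality.
v-tracks-ȳ : (proj₂ {B = λ _ → ℕ}) Tracks ȳ {p}
-- The ordinate of `NW 0` computes to `+ (p + 0)`, which also explains `m≤m+n p 0` for `T2`.
v-tracks-ȳ {p} (T1 {β = β}) = inj₁ (cong +_ (cong (λ n → β + n) (sym (+-identityʳ p))))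
v-tracks-ȳ {p} (T2 {q = q} q<p) = inj₂ (refl , ℤ.+≤+ (≤-trans (<⇒≤ (recompute (q <? p) q<p)) (m≤m+n p 0)))
v-tracks-ȳ {p} (T3 {ℓ = ℓ} {m} {h}) = inj₂ (refl , (begin
  + ℓ                             ≡⟨ [m+n]-m≡n (suc m) ℓ ⟨
  + (suc m + ℓ) ℤ.- + suc m       ≤⟨ ℤ.+-monoˡ-≤ (ℤ.- + suc m) (ℤ.+≤+ m+ℓ<p) ⟩
  + p ℤ.- + suc m                 ∎))
  where
  open ℤ.≤-Reasoning
  m+ℓ<p : m + ℓ < p
  m+ℓ<p = subst (_< p) (+-comm ℓ m) (recompute (ℓ + m <? p) h)
v-tracks-ȳ {p} (T4 {ℓ = ℓ} {m} {β} eq) = inj₁ (cong (λ i → + suc β ℤ.+ i) (begin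
  + ℓ                             ≡⟨ [m+n]-m≡n (suc m) ℓ ⟨
  + (suc m + ℓ) ℤ.- + suc m       ≡⟨ cong (λ n → + n ℤ.- + suc m) m+ℓ+1≡p ⟩
  + p ℤ.- + suc m                 ∎))
  where
  open ≡-Reasoning
  m+ℓ+1≡p : suc m + ℓ ≡ p
  m+ℓ+1≡p = trans (cong suc (+-comm m ℓ)) (recompute (suc (ℓ + m) ≟ p) eq)
v-tracks-ȳ T5 = inj₁ refl
v-tracks-ȳ T6 = inj₁ refl
v-tracks-ȳ T7 = inj₁ refl

sumℤ²-components : ∀ (w̄ : List (TStep p)) →
                   sumℤ² (map valueT w̄) ≡ (sumℤ (map x̄ w̄) , sumℤ (map ȳ w̄))
sumℤ²-components []      = refl
sumℤ²-components (ā ∷ w̄) =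
  cong (λ (x , y) → x̄ ā ℤ.+ x , ȳ ā ℤ.+ y) (sumℤ²-components w̄)

-- Walks of either kind as runs from `(ε , 0)` to itself.

run⇒Łukasiewicz : Run {p} (ε , 0) w (ε , 0) w̄ → Łukasiewicz p w
run⇒Łukasiewicz r =
  sym (trans (height-run r) (ℤ.+-identityˡ _)) ,
  λ u π → let _ , _ , r′ = run-prefixˡ π r in
    subst (0ℤ ℤ.≤_) (trans (height-run r′) (ℤ.+-identityˡ _)) (ℤ.+≤+ z≤n)

run⇒Tandem : Run {p} (ε , 0) w c w̄ → Tandem p w̄
run⇒Tandem r ū π rewrite sumℤ²-components ū =
  let _ , _ , r′ = run-prefixʳ π r
      nonneg : ∀ {n i} → + n ℤ.≤ 0ℤ ℤ.+ i → 0ℤ ℤ.≤ i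
      nonneg {i = i} le = ℤ.≤-trans (ℤ.+≤+ z≤n) (subst (_ ℤ.≤_) (ℤ.+-identityˡ i) le)
  in nonneg (tracks⇒≤ width-tracks-x̄ r′) , nonneg (tracks⇒≤ v-tracks-ȳ r′)

Łukasiewicz⇒run : Łukasiewicz p w → ∃ λ w̄ → Run (ε , 0) w (ε , 0) w̄
Łukasiewicz⇒run {p} {w} (sum≡0 , nonneg) =
  let c , w̄ , r = run-LR (ε , 0) w λ u π →
                    subst (0ℤ ℤ.≤_) (sym (ℤ.+-identityˡ _)) (nonneg u π)
      height≡0  = trans (height-run r) (trans (ℤ.+-identityˡ _) sum≡0)
  in w̄ , subst (λ c → Run _ w c w̄) (height≡0⇒start (ℤ.+-injective height≡0)) r

width-v≡0⇒start : (c : Counter p) → width c ≡ 0 → proj₂ c ≡ 0 → c ≡ (ε , 0)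
width-v≡0⇒start (ε , _) _ refl = refl
width-v≡0⇒start (_ ▸ a _ _ _ , _) () _

Tandem⇒run : Tandem p w̄ → Run (ε , 0) (Ψ p w̄) (ε , 0) w̄
Tandem⇒run {p} {w̄} tandem = subst (λ c → Run c (Ψ p w̄) _ w̄) (width-v≡0⇒start _ x≡0 y≡0) (run-RL w̄)
  where
  nonneg : ∀ ū → Prefix _≡_ ū w̄ → 0ℤ ℤ.≤ sumℤ (map x̄ ū) × 0ℤ ℤ.≤ sumℤ (map ȳ ū)
  nonneg ū π = subst (λ (x , y) → 0ℤ ℤ.≤ x × 0ℤ ℤ.≤ y) (sumℤ²-components ū) (tandem ū π)
  x≡0 = nonneg⇒starts-0 width-tracks-x̄ (run-RL w̄) refl λ ū π → proj₁ (nonneg ū π)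
  y≡0 = nonneg⇒starts-0 v-tracks-ȳ     (run-RL w̄) refl λ ū π → proj₂ (nonneg ū π)

-- Step counts and weights.

-- T5 turns an up step into SE and pushes a letter; T3 and T4 turn a down
-- step into a NW step and pop one.
#SE-run : Run c w c′ w̄ → #SE w̄ + length (proj₁ c) ≡ #-1 w + length (proj₁ c′)
#SE-run []         = refl
#SE-run (T1   ∷ r) = #SE-run r
#SE-run (T2 _ ∷ r) = #SE-run r
#SE-run (T3   ∷ r) = trans (+-suc _ _) (cong suc (#SE-run r))
#SE-run (T4 _ ∷ r) = trans (+-suc _ _) (cong suc (#SE-run r))
#SE-run (T5   ∷ r) = trans (sym (+-suc _ _)) (#SE-run r)
#SE-run (T6   ∷ r) = cong suc (#SE-run r)
#SE-run (T7   ∷ r) = cong suc (#SE-run r)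

-- A word with n letters, d of which have weight -2 and the others weight p,
-- has total weight p n - (p + 2) d.
weight : ℕ → ℕ → ℕ → ℤ
weight p n d = + p ℤ.* + n ℤ.- (+ p ℤ.+ + 2) ℤ.* + d

weight-0 : ∀ p → 0ℤ ≡ weight p 0 0
weight-0 p = lemma (+ p)
  where
  lemma : ∀ p → 0ℤ ≡ p ℤ.* 0ℤ ℤ.- (p ℤ.+ + 2) ℤ.* 0ℤ
  lemma = solve-∀

weight-down : ∀ p n d → ℤ.- + 2 ℤ.+ weight p n d ≡ weight p (suc n) (suc d)
weight-down p n d = lemma (+ p) (+ n) (+ d)
  where
  lemma : ∀ p n d → ℤ.- + 2 ℤ.+ (p ℤ.* n ℤ.- (p ℤ.+ + 2) ℤ.* d) ≡
                    p ℤ.* (1ℤ ℤ.+ n) ℤ.- (p ℤ.+ + 2) ℤ.* (1ℤ ℤ.+ d)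
  lemma = solve-∀

weight-up : ∀ p n d → + p ℤ.+ weight p n d ≡ weight p (suc n) d
weight-up p n d = lemma (+ p) (+ n) (+ d)
  where
  lemma : ∀ p n d → p ℤ.+ (p ℤ.* n ℤ.- (p ℤ.+ + 2) ℤ.* d) ≡
                    p ℤ.* (1ℤ ℤ.+ n) ℤ.- (p ℤ.+ + 2) ℤ.* d
  lemma = solve-∀

k≡weight : ∀ (w : List (LStep p)) → k w ≡ weight p (length w) (#-1 w)
k≡weight {p} []           = weight-0 p
k≡weight {p} (down   ∷ w) = trans (cong (λ i → ℤ.- + 2 ℤ.+ i) (k≡weight w)) (weight-down p (length w) (#-1 w))
k≡weight {p} (up _ _ ∷ w) = trans (cong (λ i → + p ℤ.+ i) (k≡weight w)) (weight-up p (length w) (#-1 w))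

k̄Letter-NW : ∀ j .(j≤p : j ≤ p) → k̄Letter (NW j j≤p) ≡ + p
k̄Letter-NW {p} j _ = lemma (+ p) (+ j)
  where
  lemma : ∀ p j → (p ℤ.- j) ℤ.- (ℤ.- j) ≡ p
  lemma = solve-∀

-- The split on `j` lets the decision procedure evaluate `- j`, which is stuck for a variable.
#SE-NW : ∀ j .(j≤p : j ≤ p) w̄ → #SE (NW j j≤p ∷ w̄) ≡ #SE w̄
#SE-NW zero    _ _ = refl
#SE-NW (suc _) _ _ = refl

k̄≡weight : ∀ (w̄ : List (TStep p)) → k̄ w̄ ≡ weight p (length w̄) (#SE w̄)
k̄≡weight {p} []       = weight-0 p
k̄≡weight {p} (SE ∷ w̄) = trans (cong (λ i → ℤ.- + 2 ℤ.+ i) (k̄≡weight w̄)) (weight-down p (length w̄) (#SE w̄))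
k̄≡weight {p} (NW j j≤p ∷ w̄) = begin
  k̄Letter (NW j j≤p) ℤ.+ k̄ w̄                   ≡⟨ cong₂ ℤ._+_ (k̄Letter-NW j j≤p) (k̄≡weight w̄) ⟩
  + p ℤ.+ weight p (length w̄) (#SE w̄)          ≡⟨ weight-up p (length w̄) (#SE w̄) ⟩
  weight p (suc (length w̄)) (#SE w̄)            ≡⟨ cong (weight p _) (#SE-NW j j≤p w̄) ⟨
  weight p (suc (length w̄)) (#SE (NW j j≤p ∷ w̄))  ∎
  where open ≡-Reasoning

#SE≡#-1 : Run {p} (ε , 0) w (ε , 0) w̄ → #SE w̄ ≡ #-1 w
#SE≡#-1 r = trans (sym (+-identityʳ _)) (trans (#SE-run r) (+-identityʳ _))

-- Both statistics are the same function of the length and the number of `SE` or `down` steps, which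
-- runs already match.
k̄≡k : Run {p} (ε , 0) w (ε , 0) w̄ → k̄ w̄ ≡ k w
k̄≡k {p} {w} {w̄} r = begin
  k̄ w̄                           ≡⟨ k̄≡weight w̄ ⟩
  weight p (length w̄) (#SE w̄)   ≡⟨ cong₂ (weight p) (run-length r) (#SE≡#-1 r) ⟩
  weight p (length w) (#-1 w)   ≡⟨ k≡weight w ⟨
  k w                           ∎
  where open ≡-Reasoning

-- The bijection and its inverse.

bijection : ∀ p → Inverse (subset (Łukasiewicz p)) (subset (Tandem p))
bijection p = record
  { to        = λ (_ , luk) → let w̄ , r = Łukasiewicz⇒run luk in w̄ , run⇒Tandem r
  ; from      = λ (w̄ , tan) → Ψ p w̄ , run⇒Łukasiewicz (Tandem⇒run tan)
  ; to-cong   = λ {x} {y} → to-cong x y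
  ; from-cong = cong (Ψ p)
  ; inverse   = (λ {x} {y} → inverseˡ x y) , λ {x} {y} → inverseʳ x y
  }
  where
  -- `to` extracts its word from the membership proof. By `LR-run` that word is the value of `Φ`, so
  -- it depends on `w` alone.
  to-cong : ∀ ((w , luk) (w′ , luk′) : ∃ (Łukasiewicz p)) → w ≡ w′ →
            proj₁ (Łukasiewicz⇒run luk) ≡ proj₁ (Łukasiewicz⇒run luk′)
  to-cong (_ , luk) (_ , luk′) refl = just-injective
    (trans (sym (LR-run (proj₂ (Łukasiewicz⇒run luk)))) (LR-run (proj₂ (Łukasiewicz⇒run luk′))))
  -- Two runs read `Ψ p w̄` from `(ε , 0)`, one obtained forward and one backward; `LR` identifies
  -- their outputs.
  inverseˡ : ∀ ((w̄ , _) : ∃ (Tandem p)) ((w , luk) : ∃ (Łukasiewicz p)) →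
             w ≡ Ψ p w̄ → proj₁ (Łukasiewicz⇒run luk) ≡ w̄
  inverseˡ (_ , tan) (_ , luk) refl = just-injective
    (trans (sym (LR-run (proj₂ (Łukasiewicz⇒run luk)))) (LR-run (Tandem⇒run tan)))
  inverseʳ : ∀ ((w , luk) : ∃ (Łukasiewicz p)) ((w̄ , _) : ∃ (Tandem p)) →
             w̄ ≡ proj₁ (Łukasiewicz⇒run luk) → Ψ p w̄ ≡ w
  inverseʳ (_ , luk) _ refl = cong proj₂ (RL-run (proj₂ (Łukasiewicz⇒run luk)))

theorem6 : (p : ℕ) → p ≥ 1 →
    Σ[ φ ∈ Inverse (subset (Łukasiewicz p)) (subset (Tandem p)) ]
    (∀ w → Φ p (proj₁ w) ≡ just (proj₁ (Inverse.to φ w)))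
    × (∀ w̄ → Ψ p (proj₁ w̄) ≡ proj₁ (Inverse.from φ w̄))
    × (∀ w → length (proj₁ (Inverse.to φ w)) ≡ length (proj₁ w))
    × (∀ w → k̄ (proj₁ (Inverse.to φ w)) ≡ k (proj₁ w))
    × (∀ w → #SE (proj₁ (Inverse.to φ w)) ≡ #-1 (proj₁ w))
theorem6 p _ =
  bijection p ,
  LR-run ∘ run ,
  (λ _ → refl) ,
  run-length ∘ run ,
  k̄≡k ∘ run ,
  #SE≡#-1 ∘ run
  where
  run : ((w , luk) : ∃ (Łukasiewicz p)) → Run (ε , 0) w (ε , 0) (proj₁ (Łukasiewicz⇒run luk))
  run (_ , luk) = proj₂ (Łukasiewicz⇒run luk)
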